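{- The following decision problem is fixed-parameter tractable ($\mathrm{FPT}$) with the number $k$ of colors (reachability sets) as parameter: given a generalized reachability game $\mathcal{G} = (\mathcal{A}, \mathrm{GenReach}(F_1,\ldots,F_k))$ and a starting vertex $v_0$, decide whether Eve wins from $v_0$.
   Context: An arena $\mathcal{A} = (V,(V_\circ,V_\Box),E)$ consists of a finite directed graph $(V,E)$, in which every vertex has at least one outgoing edge, and a partition $(V_\circ,V_\Box)$ of $V$: vertices in $V_\circ$ are controlled by Eve, vertices in $V_\Box$ by Adam. A play is an infinite path $\pi = v_0,v_1,v_2,\ldots$ in the graph. From a starting vertex $v_0$, at each step the player controlling the current vertex chooses an outgoing edge, and the play moves along it. A strategy for Eve is a function $\sigma : V^*\cdot V_\circ \to V$ with $(v,\sigma(w\cdot v))\in E$ for all $w \in V^*$, $v \in V_\circ$; strategies $\tau$ for Adam are defined similarly with $V_\Box$. A starting vertex $v_0$ and strategies $\sigma,\tau$ determine a unique play $\pi(v_0,\sigma,\tau)$. A game is a pair $(\mathcal{A},\Phi)$ with $\Phi$ a set of plays; Eve wins a play iff it belongs to $\Phi$, and Adam wins it otherwise. Eve wins from $v_0$ if she has a strategy $\sigma$ such that for every strategy $\tau$ of Adam, $\pi(v_0,\sigma,\tau)\in\Phi$. Given subsets $F_1,\ldots,F_k \subseteq V$ (also called colors), the generalized reachability objective is $$\mathrm{GenReach}(F_1,\ldots,F_k) = \{ v_0,v_1,v_2,\ldots \mid \forall i\in\{1,\ldots,k\},\ \exists p_i\in\mathbb{N},\ v_{p_i}\in F_i\}.$$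 A generalized reachability game is a game of the form $(\mathcal{A},\mathrm{GenReach}(F_1,\ldots,F_k))$. The input is the explicitly given finite graph, partition, sets $F_1,\ldots,F_k$ and starting vertex. Fixed-parameter tractable means decidable in time $f(k)\cdot \mathrm{poly}(N)$, where $N$ is the input size and $f$ is a computable function. -}

module Defs where

open import Data.Bool using (Bool; true; false)
open import Data.Fin using (Fin; toℕ)
open import Data.Fin.Subset using (Subset; _∈_; Nonempty)
open import Data.List using (List; []; _∷_; _∷ʳ_; foldr)
open import Data.Nat using (ℕ; zero; suc; _+_; _*_; _≤_)
open import Data.Product using (Σ; _×_; _,_; ∃; ∃-syntax; proj₁; proj₂)
open import Data.Vec using (Vec; []; _∷_; lookup; tabulate)
open import Function.Bundles using (_⇔_)
open import Level using (0ℓ)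
open import Relation.Binary.PropositionalEquality using (_≡_; refl)
open import Relation.Unary using (Pred)

------------------------------------------------------------------------
-- Games

data Player : Set where
  eve adam : Player

-- The vertex set is Fin order; the partition of the vertices is given by the
-- owner function, and edgesFrom v is the set of out-neighbours of v.
record Arena : Set where
  field
    order     : ℕ
    owner     : Fin order → Player
    edgesFrom : Fin order → Subset order
    total     : ∀ v → Nonempty (edgesFrom v)

  V : Set
  V = Fin order

  _⟶_ : V → V → Set
  v ⟶ w = w ∈ edgesFrom v

  record Play : Set where
    field
      at   : ℕ → V
      path : ∀ i → at i ⟶ at (suc i)

  -- move w v chooses a successor for the finite word w · v, where v is
  -- controlled by P.
  record Strategy (P : Player) : Set where
    field
      move  : List V → (v : V) → owner v ≡ P → V
      legal : ∀ w v (p : owner v ≡ P) → v ⟶ move w v p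

  module _ (v₀ : V) (σ : Strategy eve) (τ : Strategy adam) where

    chosen : List V → (v : V) (P : Player) → owner v ≡ P → ∃[ u ] v ⟶ u
    chosen w v eve  p = Strategy.move σ w v p , Strategy.legal σ w v p
    chosen w v adam p = Strategy.move τ w v p , Strategy.legal τ w v p

    next : List V → (v : V) → ∃[ u ] v ⟶ u
    next w v = chosen w v (owner v) refl

    -- The vertices visited before time i, in chronological order, and the
    -- vertex at time i.
    position : ℕ → List V × V
    position zero    = [] , v₀
    position (suc i) =
      let (w , v) = position i in w ∷ʳ v , proj₁ (next w v)

    outcome : Play
    outcome = record
      { at   = λ i → proj₂ (position i)
      ; path = λ i → let (w , v) = position i in proj₂ (next w v)
      }

record Game : Set₁ where
  field
    arena : Arena
  open Arena arena public
  field
    Φ : Pred Play 0ℓ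

  EveWinsFrom : V → Set
  EveWinsFrom v₀ =
    Σ (Strategy eve) λ σ → (τ : Strategy adam) → Φ (outcome v₀ σ τ)

GenReach : (𝒜 : Arena) {k : ℕ} →
           Vec (Subset (Arena.order 𝒜)) k → Pred (Arena.Play 𝒜) 0ℓ
GenReach 𝒜 F π = ∀ i → ∃[ p ] Arena.Play.at π p ∈ lookup F i

------------------------------------------------------------------------
-- Model of computation: first-order, call-by-value, mutually recursive
-- functions on binary trees, in the style of Jones, "Computability and
-- Complexity from a Programming Perspective".

data Tree : Set where
  nil : Tree
  _∙_ : Tree → Tree → Tree

size : Tree → ℕ
size nil     = 1
size (l ∙ r) = suc (size l + size r)

-- Expressions over m function symbols, of arities ar, with n variables in
-- scope.  In case e e₀ e₁, the branch e₁ binds the left subtree as variable 0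
-- and the right subtree as variable 1.
data Exp {m : ℕ} (ar : Fin m → ℕ) (n : ℕ) : Set where
  var  : Fin n → Exp ar n
  nil  : Exp ar n
  cons : Exp ar n → Exp ar n → Exp ar n
  case : Exp ar n → Exp ar n → Exp ar (suc (suc n)) → Exp ar n
  call : (g : Fin m) → Vec (Exp ar n) (ar g) → Exp ar n

record Program : Set where
  field
    functions : ℕ
    arity     : Fin functions → ℕ
    body      : (g : Fin functions) → Exp arity (arity g)
    main      : Exp arity 1

-- Evaluation with unit cost per evaluated expression node.  This is a
-- reasonable cost measure: trees are immutable and can only be tested for
-- being nil, so they may be represented by shared pointers, and a run of cost t
-- allocates at most t cells.  A Turing machine therefore simulates such a run
-- in time polynomial in t and the size of the input, and conversely a Turing
-- machine step takes a bounded number of evaluation steps.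
module _ (p : Program) where
  open Program p

  mutual
    data Eval {n : ℕ} (ρ : Vec Tree n) : Exp arity n → Tree → ℕ → Set where
      var  : ∀ x → Eval ρ (var x) (lookup ρ x) 1
      nil  : Eval ρ nil nil 1
      cons : ∀ {e₁ e₂ v₁ v₂ t₁ t₂} →
             Eval ρ e₁ v₁ t₁ → Eval ρ e₂ v₂ t₂ →
             Eval ρ (cons e₁ e₂) (v₁ ∙ v₂) (suc (t₁ + t₂))
      case-nil  : ∀ {e e₀ e₁ v t₁ t₂} →
                  Eval ρ e nil t₁ → Eval ρ e₀ v t₂ →
                  Eval ρ (case e e₀ e₁) v (suc (t₁ + t₂))
      case-cons : ∀ {e e₀ e₁ l r v t₁ t₂} →
                  Eval ρ e (l ∙ r) t₁ → Eval (l ∷ r ∷ ρ) e₁ v t₂ →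
                  Eval ρ (case e e₀ e₁) v (suc (t₁ + t₂))
      call : ∀ {g es vs v t₁ t₂} →
             EvalArgs ρ es vs t₁ → Eval vs (body g) v t₂ →
             Eval ρ (call g es) v (suc (t₁ + t₂))

    data EvalArgs {n : ℕ} (ρ : Vec Tree n) :
                  ∀ {a} → Vec (Exp arity n) a → Vec Tree a → ℕ → Set where
      []  : EvalArgs ρ [] [] 0
      _∷_ : ∀ {a e v t₁ t₂} {es : Vec (Exp arity n) a} {vs} →
            Eval ρ e v t₁ → EvalArgs ρ es vs t₂ →
            EvalArgs ρ (e ∷ es) (v ∷ vs) (t₁ + t₂)

-- Runs p x y t : on input x, p halts with output y after exactly t steps.
Runs : Program → Tree → Tree → ℕ → Set
Runs p x y t = Eval p (x ∷ []) (Program.main p) y t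

------------------------------------------------------------------------
-- Encodings

encodeBool : Bool → Tree
encodeBool false = nil
encodeBool true  = nil ∙ nil

encodeℕ : ℕ → Tree
encodeℕ zero    = nil
encodeℕ (suc n) = nil ∙ encodeℕ n

encodeVec : {A : Set} → (A → Tree) → ∀ {n} → Vec A n → Tree
encodeVec enc []       = nil
encodeVec enc (x ∷ xs) = enc x ∙ encodeVec enc xs

encodeSubset : ∀ {n} → Subset n → Tree
encodeSubset = encodeVec encodeBool

encodePlayer : Player → Tree
encodePlayer eve  = nil
encodePlayer adam = nil ∙ nil

-- The list of vertices, each with its owner and its row of the adjacency
-- matrix.  As every vertex has an outgoing edge, the size of the matrix is at
-- most quadratic in the number of edges.
encodeArena : Arena → Tree
encodeArena 𝒜 = encodeVec (λ t → t) (tabulate λ v →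
  encodePlayer (owner v) ∙ encodeSubset (edgesFrom v))
  where open Arena 𝒜

------------------------------------------------------------------------
-- Fixed-parameter tractability

Computable : (ℕ → ℕ) → Set
Computable f =
  Σ Program λ p → ∀ n → ∃[ t ] Runs p (encodeℕ n) (encodeℕ (f n)) t

-- Polynomials with natural coefficients, constant term first.
evalPoly : List ℕ → ℕ → ℕ
evalPoly cs x = foldr (λ c r → c + x * r) 0 cs

record ParameterizedProblem : Set₁ where
  field
    Instance  : Set
    encode    : Instance → Tree
    parameter : Instance → ℕ
    Yes       : Instance → Set

FPT : ParameterizedProblem → Set
FPT 𝒫 =
  Σ Program λ p → Σ (ℕ → ℕ) λ f → Σ (List ℕ) λ cs →
    Computable f ×
    (∀ (x : Instance) → Σ Bool λ b → Σ ℕ λ t →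
      Runs p (encode x) (encodeBool b) t ×
      t ≤ f (parameter x) * evalPoly cs (size (encode x)) ×
      (b ≡ true ⇔ Yes x))
  where open ParameterizedProblem 𝒫

------------------------------------------------------------------------
-- Solving generalized reachability games

record GenReachInstance : Set where
  field
    𝒜      : Arena
    colors : ℕ
    F      : Vec (Subset (Arena.order 𝒜)) colors
    v₀     : Arena.V 𝒜

  game : Game
  game = record { arena = 𝒜 ; Φ = GenReach 𝒜 F }

GenReachProblem : ParameterizedProblem
GenReachProblem = record
  { Instance  = GenReachInstance
  ; encode    = λ x → let open GenReachInstance x in
                encodeArena 𝒜 ∙ (encodeVec encodeSubset F ∙ encodeℕ (toℕ v₀))
  ; parameter = GenReachInstance.colors
  ; Yes       = λ x → let open GenReachInstance x in
                Game.EveWinsFrom game v₀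
  }

{-# OPTIONS --safe #-}
module Submission where

-- Let W i v S say that Eve can force a play from v whose first i vertices meet all
-- colors in S.  W (i + 1) v S is the disjunction (if Eve owns v) or the conjunction
-- (if Adam owns v) of W i u (S ─ C) over the successors u of v, where C is the set of
-- colors of v.  W i increases with i and has n · 2^k entries, so it is stable from
-- i = 2^k · n on.  Eve wins from a true entry by moving to true entries of smaller i;
-- Adam wins from a false entry of the stable W by staying in false entries, since
-- every entry with S = ∅ is true.  For fixed i and v, W i v is stored as a binary
-- decision tree over S, on which the recursion for W acts by tree recursion.

open import Defs

open import Data.Bool using (Bool; true; false; _∧_; _∨_; not)
import Data.Bool.Properties as Bool
open import Data.Empty using (⊥-elim)
open import Data.Fin using (Fin; zero; suc; toℕ; #_)
open import Data.Fin.Properties using (any?)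
open import Data.Fin.Subset using (Subset; _∈_; _─_; ⊤)
open import Data.Fin.Subset.Properties using (_∈?_)
open import Data.List using (List; []; _∷_; _∷ʳ_; foldl; length)
open import Data.List.Properties using (foldl-∷ʳ; length-++)
open import Data.Nat using
  (ℕ; zero; suc; _+_; _*_; _∸_; _^_; _⊔_; _≤_; _<_; z≤n; s≤s; _≤?_; >-nonZero)
open import Data.Nat.GeneralisedArithmetic using (fold; fold-+)
open import Data.Nat.Properties
open import Data.Nat.Tactic.RingSolver using (solve-∀)
open import Data.Product using (_×_; _,_; ∃-syntax; proj₁; proj₂)
open import Data.Sum using (_⊎_; inj₁; inj₂)
open import Data.Vec using
  (Vec; []; _∷_; head; tail; lookup; map; replicate; tabulate; here; there)
open import Data.Vec.Properties using
  (lookup-map; lookup-replicate; lookup∘tabulate; lookup⇒[]=; []=⇒lookup)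
open import Function using (_∘_; case_of_)
open import Function.Bundles using (_⇔_; mk⇔)
open import Relation.Binary.PropositionalEquality
open import Relation.Nullary using (¬_; yes; no; contradiction)
open import Relation.Nullary.Decidable using (_×-dec_)

maximum : ∀ {n} (f : Fin n → ℕ) → ∃[ m ] (∀ i → f i ≤ m)
maximum {zero}  f = 0 , λ ()
maximum {suc n} f with maximum (f ∘ suc)
... | m , f≤m = f zero ⊔ m , λ where
  zero    → m≤m⊔n (f zero) m
  (suc i) → m≤n⇒m≤o⊔n (f zero) (f≤m i)

-- Boolean functions on the subsets of a k-element set, as decision trees.
data Table : ℕ → Set where
  leaf : Bool → Table 0
  node : ∀ {k} → Table k → Table k → Table (suc k)

_at_ : ∀ {k} → Table k → Subset k → Bool
leaf b   at []          = b
node l r at (false ∷ S) = l at S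
node l r at (true  ∷ S) = r at S

-- Inclusion of tables and the number of true entries

count : ∀ {k} → Table k → ℕ
count (leaf false) = 0
count (leaf true)  = 1
count (node l r)   = count l + count r

count≤2^k : ∀ {k} (t : Table k) → count t ≤ 2 ^ k
count≤2^k (leaf false) = z≤n
count≤2^k (leaf true)  = ≤-refl
count≤2^k {suc k} (node l r) =
  +-mono-≤ (count≤2^k l) (≤-trans (count≤2^k r) (≤-reflexive (sym (+-identityʳ (2 ^ k)))))

counts : ∀ {k m} → Vec (Table k) m → ℕ
counts []       = 0
counts (t ∷ ts) = count t + counts ts

counts≤ : ∀ {k m} (ts : Vec (Table k) m) → counts ts ≤ m * 2 ^ k
counts≤ []       = z≤n
counts≤ (t ∷ ts) = +-mono-≤ (count≤2^k t) (counts≤ ts)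

+-squeeze : ∀ {a b c d} → a ≤ b → c ≤ d → b + d ≤ a + c → b ≤ a × d ≤ c
+-squeeze {a} {b} {c} {d} a≤b c≤d b+d≤a+c =
  +-cancelʳ-≤ d b a (≤-trans b+d≤a+c (+-monoʳ-≤ a c≤d)) ,
  +-cancelˡ-≤ b d c (≤-trans b+d≤a+c (+-monoˡ-≤ c a≤b))

_⊑_ : ∀ {k} → Table k → Table k → Set
t ⊑ u = ∀ S → t at S ≡ true → u at S ≡ true

count-mono : ∀ {k} (t u : Table k) → t ⊑ u → count t ≤ count u
count-mono (leaf false) (leaf _)     t⊑u = z≤n
count-mono (leaf true)  (leaf true)  t⊑u = ≤-refl
count-mono (leaf true)  (leaf false) t⊑u with () ← t⊑u [] refl
count-mono (node l r) (node l′ r′) t⊑u =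
  +-mono-≤ (count-mono l l′ (t⊑u ∘ (false ∷_))) (count-mono r r′ (t⊑u ∘ (true ∷_)))

-- Inclusion already bounds the counts of corresponding subtrees in one direction, so a total that
-- does not grow forces equality in each of them (`+-squeeze`). In this way a comparison of numbers
-- yields equality of tables.
count-reflects : ∀ {k} (t u : Table k) → t ⊑ u → count u ≤ count t → t ≡ u
count-reflects (leaf false) (leaf false) t⊑u u≤t = refl
count-reflects (leaf true)  (leaf true)  t⊑u u≤t = refl
count-reflects (leaf true)  (leaf false) t⊑u u≤t with () ← t⊑u [] refl
count-reflects (node l r) (node l′ r′) t⊑u u≤t =
  let l⊑ = t⊑u ∘ (false ∷_)
      r⊑ = t⊑u ∘ (true ∷_)
      (l≥ , r≥) = +-squeeze (count-mono l l′ l⊑) (count-mono r r′ r⊑) u≤t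
  in cong₂ node (count-reflects l l′ l⊑ l≥) (count-reflects r r′ r⊑ r≥)

counts-mono : ∀ {k m} (ts us : Vec (Table k) m) →
              (∀ v → lookup ts v ⊑ lookup us v) → counts ts ≤ counts us
counts-mono []       []       ts⊑us = z≤n
counts-mono (t ∷ ts) (u ∷ us) ts⊑us =
  +-mono-≤ (count-mono t u (ts⊑us zero)) (counts-mono ts us (ts⊑us ∘ suc))

counts-reflects : ∀ {k m} (ts us : Vec (Table k) m) →
                  (∀ v → lookup ts v ⊑ lookup us v) → counts us ≤ counts ts → ts ≡ us
counts-reflects []       []       ts⊑us us≤ts = refl
counts-reflects (t ∷ ts) (u ∷ us) ts⊑us us≤ts =
  let t⊑  = ts⊑us zero
      ts⊑ = ts⊑us ∘ suc
      (t≥ , ts≥) = +-squeeze (count-mono t u t⊑) (counts-mono ts us ts⊑) us≤ts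
  in cong₂ _∷_ (count-reflects t u t⊑ t≥) (counts-reflects ts us ts⊑ ts≥)

-- Table operations for one step of the recursion

constant : Bool → ∀ k → Table k
constant b zero    = leaf b
constant b (suc k) = node (constant b k) (constant b k)

isEmpty : ∀ k → Table k
isEmpty zero    = leaf true
isEmpty (suc k) = node (isEmpty k) (constant false k)

-- The winning value of a player is absorbing for that player's connective.
good : Player → Bool
good eve  = true
good adam = false

choose : Player → Bool → Bool → Bool
choose eve  = _∨_
choose adam = _∧_

pointwise : ∀ {k} → Player → Table k → Table k → Table k
pointwise P (leaf a)   (leaf b)     = leaf (choose P a b)
pointwise P (node l r) (node l′ r′) = node (pointwise P l l′) (pointwise P r r′)

subtract : ∀ {k} → Subset k → Table k → Table k
subtract []          t          = t
subtract (false ∷ C) (node l r) = node (subtract C l) (subtract C r)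
-- A color in `C` is absent after the subtraction, so both branches continue in `l`, the branch for
-- its absence.
subtract (true ∷ C)  (node l r) = node (subtract C l) (subtract C l)

aggregate : ∀ {k m} → Player → Subset m → Vec (Table k) m → Table k
-- The neutral element of `choose P`: false for the disjunction, true for the conjunction.
aggregate {k} P []           []       = constant (not (good P)) k
aggregate     P (false ∷ es) (t ∷ ts) = aggregate P es ts
aggregate     P (true  ∷ es) (t ∷ ts) = pointwise P t (aggregate P es ts)

-- The rows and `H` lose one vertex at a time together, so `map head H` is always the color set of
-- the current vertex. `X` stays whole, since a successor may be any vertex.
step : ∀ {k m n} → Vec (Player × Subset n) m → Vec (Subset m) k →
       Vec (Table k) n → Vec (Table k) m
step []               H X = []
step ((P , es) ∷ rows) H X =
  subtract (map head H) (aggregate P es X) ∷ step rows (map tail H) X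

-- Values of the table operations

constant-at : ∀ b k (S : Subset k) → constant b k at S ≡ b
constant-at b zero    []          = refl
constant-at b (suc k) (false ∷ S) = constant-at b k S
constant-at b (suc k) (true  ∷ S) = constant-at b k S

isEmpty-sound : ∀ k (S : Subset k) → isEmpty k at S ≡ true → ∀ i → lookup S i ≡ false
isEmpty-sound (suc k) (false ∷ S) p zero    = refl
isEmpty-sound (suc k) (false ∷ S) p (suc i) = isEmpty-sound k S p i
isEmpty-sound (suc k) (true  ∷ S) p i with () ← trans (sym p) (constant-at false k S)

isEmpty-complete : ∀ k (S : Subset k) → (∀ i → lookup S i ≡ false) → isEmpty k at S ≡ true
isEmpty-complete zero    []          p = refl
isEmpty-complete (suc k) (false ∷ S) p = isEmpty-complete k S (p ∘ suc)
isEmpty-complete (suc k) (true  ∷ S) p with () ← p zero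

pointwise-at : ∀ {k} P (t u : Table k) S →
               pointwise P t u at S ≡ choose P (t at S) (u at S)
pointwise-at P (leaf a)   (leaf b)     []          = refl
pointwise-at P (node l r) (node l′ r′) (false ∷ S) = pointwise-at P l l′ S
pointwise-at P (node l r) (node l′ r′) (true  ∷ S) = pointwise-at P r r′ S

subtract-at : ∀ {k} (C : Subset k) t S → subtract C t at S ≡ t at (S ─ C)
subtract-at []          t          []          = refl
subtract-at (false ∷ C) (node l r) (false ∷ S) = subtract-at C l S
subtract-at (false ∷ C) (node l r) (true  ∷ S) = subtract-at C r S
subtract-at (true  ∷ C) (node l r) (false ∷ S) = subtract-at C l S
subtract-at (true  ∷ C) (node l r) (true  ∷ S) = subtract-at C l S

choose-good : ∀ P a b → choose P a b ≡ good P → a ≡ good P ⊎ b ≡ good P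
choose-good eve  true  b p = inj₁ refl
choose-good eve  false b p = inj₂ p
choose-good adam true  b p = inj₂ p
choose-good adam false b p = inj₁ refl

choose-goodˡ : ∀ P b → choose P (good P) b ≡ good P
choose-goodˡ eve  b = refl
choose-goodˡ adam b = refl

choose-goodʳ : ∀ P a → choose P a (good P) ≡ good P
choose-goodʳ eve  = Bool.∨-zeroʳ
choose-goodʳ adam = Bool.∧-zeroʳ

-- Stated for the value `good P`, this and `aggregate-absorbs` treat a true disjunction and a false
-- conjunction alike. Universal statements about the opposite value follow by contradiction.
aggregate-attained : ∀ {k m} P (es : Subset m) (ts : Vec (Table k) m) S →
                     aggregate P es ts at S ≡ good P →
                     ∃[ u ] u ∈ es × lookup ts u at S ≡ good P
aggregate-attained {k} P [] [] S p =
  ⊥-elim (Bool.not-¬ refl (trans (sym p) (constant-at (not (good P)) k S)))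
aggregate-attained P (false ∷ es) (t ∷ ts) S p with aggregate-attained P es ts S p
... | u , u∈es , q = suc u , there u∈es , q
aggregate-attained P (true ∷ es) (t ∷ ts) S p
  with choose-good P (t at S) _ (trans (sym (pointwise-at P t _ S)) p)
... | inj₁ q = zero , here , q
... | inj₂ q with aggregate-attained P es ts S q
...   | u , u∈es , r = suc u , there u∈es , r

aggregate-absorbs : ∀ {k m} P (es : Subset m) (ts : Vec (Table k) m) S {u} →
                    u ∈ es → lookup ts u at S ≡ good P → aggregate P es ts at S ≡ good P
aggregate-absorbs P (true ∷ es) (t ∷ ts) S here q =
  trans (pointwise-at P t _ S) (trans (cong (λ a → choose P a _) q) (choose-goodˡ P _))
aggregate-absorbs P (true ∷ es) (t ∷ ts) S (there u∈es) q =
  trans (pointwise-at P t _ S)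
    (trans (cong (choose P (t at S)) (aggregate-absorbs P es ts S u∈es q)) (choose-goodʳ P _))
aggregate-absorbs P (false ∷ es) (t ∷ ts) S (there u∈es) q =
  aggregate-absorbs P es ts S u∈es q

lookup-─ : ∀ {n} (S C : Subset n) i → lookup (S ─ C) i ≡ lookup S i ∧ not (lookup C i)
lookup-─ (s ∷ S) (false ∷ C) zero    = sym (Bool.∧-identityʳ s)
lookup-─ (s ∷ S) (true  ∷ C) zero    = sym (Bool.∧-zeroʳ s)
lookup-─ (_ ∷ S) (false ∷ C) (suc i) = lookup-─ S C i
lookup-─ (_ ∷ S) (true  ∷ C) (suc i) = lookup-─ S C i

column : ∀ {k m} → Vec (Subset m) k → Fin m → Subset k
column H v = map (λ G → lookup G v) H

column-zero : ∀ {k m} (H : Vec (Subset (suc m)) k) → map head H ≡ column H zero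
column-zero []            = refl
column-zero ((x ∷ _) ∷ H) = cong (x ∷_) (column-zero H)

column-suc : ∀ {k m} (H : Vec (Subset (suc m)) k) v → column (map tail H) v ≡ column H (suc v)
column-suc []             v = refl
column-suc ((_ ∷ xs) ∷ H) v = cong (lookup xs v ∷_) (column-suc H v)

lookup-step : ∀ {k m n} (rows : Vec (Player × Subset n) m) (H : Vec (Subset m) k) X v →
              lookup (step rows H X) v ≡
              subtract (column H v)
                (aggregate (proj₁ (lookup rows v)) (proj₂ (lookup rows v)) X)
lookup-step ((P , es) ∷ rows) H X zero =
  cong (λ C → subtract C (aggregate P es X)) (column-zero H)
lookup-step ((P , es) ∷ rows) H X (suc v) =
  trans (lookup-step rows (map tail H) X v)
    (cong (λ C → subtract C (aggregate (proj₁ (lookup rows v)) (proj₂ (lookup rows v)) X))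
      (column-suc H v))

-- Determinacy

module Solution (x : GenReachInstance) where

  open GenReachInstance x using (𝒜; F; v₀) renaming (colors to k)
  open Arena 𝒜

  rows : Vec (Player × Subset order) order
  rows = tabulate λ v → owner v , edgesFrom v

  X : ℕ → Vec (Table k) order
  X = fold (replicate order (isEmpty k)) (step rows F)

  W : ℕ → V → Subset k → Bool
  W i v S = lookup (X i) v at S

  W-zero : ∀ v S → W 0 v S ≡ isEmpty k at S
  W-zero v S = cong (_at S) (lookup-replicate v (isEmpty k))

  W-suc : ∀ i v S →
          W (suc i) v S ≡ aggregate (owner v) (edgesFrom v) (X i) at (S ─ column F v)
  W-suc i v S = trans (cong (_at S) (lookup-step rows F (X i) v))
    (trans (cong (λ (P , es) → subtract (column F v) (aggregate P es (X i)) at S)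
             (lookup∘tabulate (λ v → owner v , edgesFrom v) v))
      (subtract-at (column F v) (aggregate (owner v) (edgesFrom v) (X i)) S))

  attained : ∀ i {v} S → W (suc i) v S ≡ good (owner v) →
             ∃[ u ] v ⟶ u × W i u (S ─ column F v) ≡ good (owner v)
  attained i S p = aggregate-attained _ _ _ _ (trans (sym (W-suc i _ S)) p)

  absorbs : ∀ i {v} S {u} → v ⟶ u → W i u (S ─ column F v) ≡ good (owner v) →
            W (suc i) v S ≡ good (owner v)
  absorbs i S e p = trans (W-suc i _ S) (aggregate-absorbs _ _ _ _ e p)

  -- For Eve a single successor is enough, and `total` provides one. For Adam a false value would be
  -- attained at a successor, against the hypothesis.
  all-true : ∀ i v S → (∀ {u} → v ⟶ u → W i u (S ─ column F v) ≡ true) → W (suc i) v S ≡ true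
  all-true i v S h with owner v | attained i {v} S | absorbs i {v} S
  ... | eve  | _   | abs = let (u , e) = total v in abs e (h e)
  ... | adam | att | _ with W (suc i) v S
  ...   | true  = refl
  ...   | false = let (u , e , p) = att refl in trans (sym p) (h e)

  -- At level 0, `S` is empty and stays empty after subtraction. Above it, Eve keeps her true
  -- successor by induction. For Adam, a successor that is false at the higher level is by induction
  -- false at the lower one too, where it would make the value at `v` false.
  W-monotone : ∀ i v S → W i v S ≡ true → W (suc i) v S ≡ true
  W-monotone zero v S p = all-true 0 v S λ {u} _ →
    trans (W-zero u _) (isEmpty-complete k _ λ i →
      trans (lookup-─ S (column F v) i)
        (cong (_∧ _) (isEmpty-sound k S (trans (sym (W-zero v S)) p) i)))
  W-monotone (suc i) v S p
    with owner v | attained i {v} S | absorbs i {v} S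
       | attained (suc i) {v} S | absorbs (suc i) {v} S
  ... | eve | att | _ | _ | abs =
    let (u , e , q) = att p in abs e (W-monotone i u _ q)
  ... | adam | _ | abs | att | _ with W (suc (suc i)) v S
  ...   | true  = refl
  ...   | false with att refl
  ...     | u , e , q with W i u (S ─ column F v) in r
  ...       | true  = trans (sym q) (W-monotone i u _ r)
  ...       | false = trans (sym (abs e r)) p

  W-increasing : ∀ i v S → W 0 v S ≡ true → W i v S ≡ true
  W-increasing zero    v S p = p
  W-increasing (suc i) v S p = W-monotone i v S (W-increasing i v S p)

  -- As long as the tables change, each step adds a true entry by `counts-reflects`; once two
  -- consecutive ones agree, all later ones do.
  stable⊎counts≥ : ∀ i → X (suc i) ≡ X i ⊎ i ≤ counts (X i)
  stable⊎counts≥ zero = inj₂ z≤n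
  stable⊎counts≥ (suc i) with stable⊎counts≥ i
  ... | inj₁ p = inj₁ (cong (step rows F) p)
  ... | inj₂ i≤ with counts (X (suc i)) ≤? counts (X i)
  ...   | yes ≥ = inj₁ (cong (step rows F)
                    (sym (counts-reflects _ _ (λ v S → W-monotone i v S) ≥)))
  ...   | no  ≱ = inj₂ (≤-trans (s≤s i≤) (≰⇒> ≱))

  rounds : ℕ
  rounds = 2 ^ k * order

  stable : X (suc rounds) ≡ X rounds
  stable with stable⊎counts≥ rounds
  ... | inj₁ p  = p
  -- Here `X rounds` has at least `rounds` true entries. This is the number of all entries, so the
  -- next step cannot add any.
  ... | inj₂ N≤ = sym (counts-reflects _ _ (λ v S → W-monotone rounds v S)
    (≤-trans (≤-trans (counts≤ (X (suc rounds))) (≤-reflexive (*-comm order (2 ^ k)))) N≤))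

  -- The memory that the strategies recompute from the history. A history ends before the current
  -- vertex, whose colors are subtracted by the recursion for `W` itself.
  remaining : List V → Subset k
  remaining = foldl (λ S v → S ─ column F v) ⊤

  remaining-∷ʳ : ∀ w v → remaining (w ∷ʳ v) ≡ remaining w ─ column F v
  remaining-∷ʳ w v = foldl-∷ʳ _ _ v w

  -- The move made at time j keeps the value good for P, when read off X (ℓ j).
  module _ (P : Player) (ℓ : ℕ → ℕ) where

    Keeps : List V → V → V → Set
    Keeps w v u = W (suc (ℓ (length w))) v (remaining w) ≡ good P →
                  W (ℓ (length w)) u (remaining (w ∷ʳ v)) ≡ good P

    -- A legal move is due at every history, also where the value is not good, so the move cannot
    -- depend on the hypothesis of `Keeps`. It is found by search, with an arbitrary successor as
    -- fallback; in that case `attained` refutes the hypothesis.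
    keep : ∀ w v → owner v ≡ P → ∃[ u ] v ⟶ u × Keeps w v u
    keep w v refl
      with any? (λ u → (u ∈? edgesFrom v) ×-dec
                       (W (ℓ (length w)) u (remaining (w ∷ʳ v)) Bool.≟ good P))
    ... | yes (u , e , p) = u , e , λ _ → p
    ... | no ∄ = let (u , e) = total v in u , e , λ p →
      let (u′ , e′ , q) = attained (ℓ (length w)) (remaining w) p
      in ⊥-elim (∄ (u′ , e′ , trans (cong (W (ℓ (length w)) u′) (remaining-∷ʳ w v)) q))

    keeper : Strategy P
    keeper = record
      { move  = λ w v p → proj₁ (keep w v p)
      ; legal = λ w v p → proj₁ (proj₂ (keep w v p))
      }

    -- A successor that is not good for `P` is good for the opponent, who owns `v`; by `absorbs` the
    -- value at `v` would then be the opponent's as well.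
    forced : ∀ w v {Q u} → owner v ≡ Q → Q ≢ P → v ⟶ u → Keeps w v u
    forced w v {u = u} refl Q≢P e p
      with W (ℓ (length w)) u (remaining (w ∷ʳ v)) Bool.≟ good P
    ... | yes q = q
    ... | no ≢good =
      let q = absorbs (ℓ (length w)) (remaining w) e
                (trans (cong (W (ℓ (length w)) u) (sym (remaining-∷ʳ w v)))
                  (opposite (owner v) P Q≢P _ ≢good))
      in ⊥-elim (distinct (owner v) P Q≢P (trans (sym q) p))
      where
      opposite : ∀ Q P → Q ≢ P → ∀ b → b ≢ good P → b ≡ good Q
      opposite eve  eve  Q≢P b     h = contradiction refl Q≢P
      opposite eve  adam Q≢P true  h = refl
      opposite eve  adam Q≢P false h = contradiction refl h
      opposite adam eve  Q≢P true  h = contradiction refl h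
      opposite adam eve  Q≢P false h = refl
      opposite adam adam Q≢P b     h = contradiction refl Q≢P
      distinct : ∀ Q P → Q ≢ P → good Q ≢ good P
      distinct eve  eve  Q≢P _ = Q≢P refl
      distinct adam adam Q≢P _ = Q≢P refl
      distinct eve  adam Q≢P ()
      distinct adam eve  Q≢P ()

  eve-keeps : ∀ ℓ τ w v → Keeps eve ℓ w v (proj₁ (next v₀ (keeper eve ℓ) τ w v))
  -- `next` is `chosen` at the owner with `refl`. Generalizing both permits matching on the player,
  -- upon which `chosen` reduces.
  eve-keeps ℓ τ w v = by (owner v) refl
    where
    by : ∀ Q (q : owner v ≡ Q) → Keeps eve ℓ w v (proj₁ (chosen v₀ (keeper eve ℓ) τ w v Q q))
    by eve  q = proj₂ (proj₂ (keep eve ℓ w v q))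
    by adam q = forced eve ℓ w v q (λ ()) (Strategy.legal τ w v q)

  adam-keeps : ∀ ℓ σ w v → Keeps adam ℓ w v (proj₁ (next v₀ σ (keeper adam ℓ) w v))
  adam-keeps ℓ σ w v = by (owner v) refl
    where
    by : ∀ Q (q : owner v ≡ Q) → Keeps adam ℓ w v (proj₁ (chosen v₀ σ (keeper adam ℓ) w v Q q))
    by eve  q = forced adam ℓ w v q (λ ()) (Strategy.legal σ w v q)
    by adam q = proj₂ (proj₂ (keep adam ℓ w v q))

  -- Colors met along a play, and the two winning strategies

  module _ (σ : Strategy eve) (τ : Strategy adam) where

    history : ℕ → List V
    history j = proj₁ (position v₀ σ τ j)

    current : ℕ → V
    current j = proj₂ (position v₀ σ τ j)

    -- The strategies read the time off the history; this aligns the level they use with the index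
    -- of the play.
    length-history : ∀ j → length (history j) ≡ j
    length-history zero    = refl
    length-history (suc j) =
      trans (length-++ (history j)) (trans (+-comm _ 1) (cong suc (length-history j)))

    -- All colors are present at time 0, so an absent one was subtracted at some step, and the
    -- vertex of that step carries it.
    unvisited : ∀ j i → lookup (remaining (history j)) i ≡ false →
                ∃[ p ] current p ∈ lookup F i
    unvisited zero    i h with () ← trans (sym h) (lookup-replicate i true)
    unvisited (suc j) i h
      with lookup (remaining (history j)) i in p
         | trans (sym (lookup-─ (remaining (history j)) (column F (current j)) i))
             (trans (cong (λ S → lookup S i) (sym (remaining-∷ʳ (history j) (current j)))) h)
    ... | false | _ = unvisited j i p
    ... | true  | q = j , lookup⇒[]= (current j) (lookup F i)
      (trans (sym (lookup-map i _ F)) (Bool.not-injective q))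

    visited : ∀ j i {p} → p < j → current p ∈ lookup F i →
              lookup (remaining (history j)) i ≡ false
    visited (suc j) i {p} (s≤s p≤j) h =
      trans (cong (λ S → lookup S i) (remaining-∷ʳ (history j) (current j)))
        (trans (lookup-─ (remaining (history j)) (column F (current j)) i)
          (case m≤n⇒m<n∨m≡n p≤j of λ where
            (inj₁ p<j)  → cong (_∧ not (lookup (column F (current j)) i)) (visited j i p<j h)
            (inj₂ refl) → trans
              (cong (λ b → lookup (remaining (history j)) i ∧ not b)
                (trans (lookup-map i (λ G → lookup G (current j)) F) ([]=⇒lookup h)))
              (Bool.∧-zeroʳ _)))

  eve-wins : W rounds v₀ ⊤ ≡ true → Game.EveWinsFrom (GenReachInstance.game x) v₀
  eve-wins win = σ , λ τ i → unvisited σ τ rounds i (empty τ i)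
    where
    ℓ : ℕ → ℕ
    -- The level after move `j`. The level before it is one more, namely `rounds ∸ j` while
    -- `j < rounds`; later truncation is harmless, as all colors have been met by then.
    ℓ j = rounds ∸ suc j

    σ : Strategy eve
    σ = keeper eve ℓ

    invariant : ∀ τ j → j ≤ rounds →
                W (rounds ∸ j) (current σ τ j) (remaining (history σ τ j)) ≡ true
    invariant τ zero    _ = win
    invariant τ (suc j) j<N with eve-keeps ℓ τ (history σ τ j) (current σ τ j)
    ... | kept rewrite length-history σ τ j = kept
      (subst (λ i → W i (current σ τ j) (remaining (history σ τ j)) ≡ true)
        (∸-suc j<N) (invariant τ j (<⇒≤ j<N)))
      where
      ∸-suc : ∀ {i n} → i < n → n ∸ i ≡ suc (n ∸ suc i)
      ∸-suc {zero}  {suc n} _         = refl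
      ∸-suc {suc i} {suc n} (s≤s i<n) = ∸-suc i<n

    empty : ∀ τ i → lookup (remaining (history σ τ rounds)) i ≡ false
    empty τ = isEmpty-sound k _ (trans (sym (W-zero (current σ τ rounds) _))
      (subst (λ i → W i (current σ τ rounds) (remaining (history σ τ rounds)) ≡ true)
        (n∸n≡0 rounds) (invariant τ rounds ≤-refl)))

  adam-wins : W rounds v₀ ⊤ ≡ false → ¬ Game.EveWinsFrom (GenReachInstance.game x) v₀
  adam-wins lose (σ , wins) = contradiction (trans (sym lost) won) λ ()
    where
    τ : Strategy adam
    τ = keeper adam (λ _ → rounds)

    invariant : ∀ j → W rounds (current σ τ j) (remaining (history σ τ j)) ≡ false
    invariant zero    = lose
    invariant (suc j) = adam-keeps (λ _ → rounds) σ (history σ τ j) (current σ τ j)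
      -- `adam-keeps` expects the entry at level `suc rounds`. By stability it equals the one at
      -- `rounds`, so the level never drops.
      (trans (cong (λ Y → lookup Y (current σ τ j) at remaining (history σ τ j)) stable)
        (invariant j))

    bound : ∃[ m ] (∀ i → proj₁ (wins τ i) ≤ m)
    bound = maximum λ i → proj₁ (wins τ i)

    j : ℕ
    -- One past a bound on the visiting times, because the history at time `j` ends before the
    -- vertex at time `j`.
    j = suc (proj₁ bound)

    lost : W rounds (current σ τ j) (remaining (history σ τ j)) ≡ false
    lost = invariant j

    won : W rounds (current σ τ j) (remaining (history σ τ j)) ≡ true
    won = W-increasing rounds (current σ τ j) _ (trans (W-zero (current σ τ j) _)
      (isEmpty-complete k _ λ i →
        visited σ τ j i (s≤s (proj₂ bound i)) (proj₂ (wins τ i))))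

  correct : W rounds v₀ ⊤ ≡ true ⇔ Game.EveWinsFrom (GenReachInstance.game x) v₀
  correct = mk⇔ eve-wins (λ h → Bool.¬-not (λ p → adam-wins p h))

-- Cost accounting

nodes : ∀ {m n} {ar : Fin m → ℕ} → Exp ar n → ℕ
nodes* : ∀ {m n a} {ar : Fin m → ℕ} → Vec (Exp ar n) a → ℕ
nodes (var x)        = 1
nodes nil            = 1
nodes (cons e₁ e₂)   = suc (nodes e₁ + nodes e₂)
nodes (case e e₀ e₁) = suc (nodes e + (nodes e₀ + nodes e₁))
nodes (call g es)    = suc (nodes* es)
nodes* []       = 0
nodes* (e ∷ es) = nodes e + nodes* es

-- Between two calls an evaluation stays inside one expression and visits each of
-- its nodes at most once, so that it suffices to count calls.
module Calls (p : Program) where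
  open Program p

  private
    maxBody : ∃[ K ] (∀ g → nodes (body g) ≤ K)
    maxBody = maximum (nodes ∘ body)

  K : ℕ
  K = proj₁ maxBody

  infix 4 _⊢_⇓_⟨_⟩ _⊢*_⇓_⟨_⟩

  -- The index `c` stands for a bound on the number of calls, nested ones included. The exact time
  -- stays hidden, so that claims about the program mention calls only.
  record _⊢_⇓_⟨_⟩ {n} (ρ : Vec Tree n) (e : Exp arity n) (v : Tree) (c : ℕ) : Set where
    constructor cost
    field
      {time} : ℕ
      run    : Eval p ρ e v time
      time≤  : time ≤ nodes e + K * c

  record _⊢*_⇓_⟨_⟩ {n a} (ρ : Vec Tree n) (es : Vec (Exp arity n) a) (vs : Vec Tree a) (c : ℕ) :
                   Set where
    constructor cost
    field
      {time} : ℕ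
      run    : EvalArgs p ρ es vs time
      time≤  : time ≤ nodes* es + K * c

  private
    add-bounds : ∀ {t₁ t₂} a b c d → t₁ ≤ a + K * c → t₂ ≤ b + K * d →
                 t₁ + t₂ ≤ a + b + K * (c + d)
    add-bounds a b c d p q = ≤-trans (+-mono-≤ p q) (≤-reflexive (eq K a b c d))
      where
      eq : ∀ K a b c d → a + K * c + (b + K * d) ≡ a + b + K * (c + d)
      eq = solve-∀

  private
    variable
      n a c d : ℕ
      ρ : Vec Tree n
      v v₁ v₂ l r : Tree
      vs : Vec Tree a
      e e₀ e₁ e₂ : Exp arity n
      es : Vec (Exp arity n) a

  weaken : c ≤ d → ρ ⊢ e ⇓ v ⟨ c ⟩ → ρ ⊢ e ⇓ v ⟨ d ⟩
  weaken {e = e} c≤d (cost r t≤) =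
    cost r (≤-trans t≤ (+-monoʳ-≤ (nodes e) (*-monoʳ-≤ K c≤d)))

  ⇓var : ∀ {x} → ρ ⊢ var x ⇓ lookup ρ x ⟨ 0 ⟩
  ⇓var = cost (var _) (s≤s z≤n)

  ⇓nil : ρ ⊢ nil ⇓ nil ⟨ 0 ⟩
  ⇓nil = cost nil (s≤s z≤n)

  ⇓cons : ρ ⊢ e₁ ⇓ v₁ ⟨ c ⟩ → ρ ⊢ e₂ ⇓ v₂ ⟨ d ⟩ → ρ ⊢ cons e₁ e₂ ⇓ v₁ ∙ v₂ ⟨ c + d ⟩
  ⇓cons {e₁ = e₁} {c = c} {e₂ = e₂} {d = d} (cost r₁ p) (cost r₂ q) =
    cost (cons r₁ r₂) (s≤s (add-bounds (nodes e₁) (nodes e₂) c d p q))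

  ⇓case-nil : ρ ⊢ e ⇓ nil ⟨ c ⟩ → ρ ⊢ e₀ ⇓ v ⟨ d ⟩ → ρ ⊢ case e e₀ e₁ ⇓ v ⟨ c + d ⟩
  ⇓case-nil {e = e} {c = c} {e₀ = e₀} {d = d} {e₁ = e₁} (cost r₁ p) (cost r₂ q) =
    cost (case-nil r₁ r₂)
      (s≤s (≤-trans (add-bounds (nodes e) (nodes e₀) c d p q)
        (+-monoˡ-≤ (K * (c + d)) (+-monoʳ-≤ (nodes e) (m≤m+n (nodes e₀) (nodes e₁))))))

  ⇓case-cons : ρ ⊢ e ⇓ l ∙ r ⟨ c ⟩ → (l ∷ r ∷ ρ) ⊢ e₁ ⇓ v ⟨ d ⟩ →
               ρ ⊢ case e e₀ e₁ ⇓ v ⟨ c + d ⟩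
  ⇓case-cons {e = e} {c = c} {e₁ = e₁} {d = d} {e₀ = e₀} (cost r₁ p) (cost r₂ q) =
    cost (case-cons r₁ r₂)
      (s≤s (≤-trans (add-bounds (nodes e) (nodes e₁) c d p q)
        (+-monoˡ-≤ (K * (c + d)) (+-monoʳ-≤ (nodes e) (m≤n+m (nodes e₁) (nodes e₀))))))

  ⇓call : ∀ {g es} {vs : Vec Tree (arity g)} →
          ρ ⊢* es ⇓ vs ⟨ c ⟩ → vs ⊢ body g ⇓ v ⟨ d ⟩ → ρ ⊢ call g es ⇓ v ⟨ suc (c + d) ⟩
  ⇓call {c = c} {d = d} {g = g} {es = es} (cost r₁ p) (cost r₂ q) =
    cost (call r₁ r₂)
      -- The `suc` in the call count contributes the `K` that pays for the nodes of the body.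
      (s≤s (≤-trans (+-mono-≤ p (≤-trans q (+-monoˡ-≤ (K * d) (proj₂ maxBody g))))
        (≤-reflexive (eq K (nodes* es) c d))))
    where
    eq : ∀ K n c d → n + K * c + (K + K * d) ≡ n + K * suc (c + d)
    eq = solve-∀

  infixr 5 _∷*_

  []* : ρ ⊢* [] ⇓ [] ⟨ 0 ⟩
  []* = cost [] z≤n

  _∷*_ : ρ ⊢ e ⇓ v ⟨ c ⟩ → ρ ⊢* es ⇓ vs ⟨ d ⟩ → ρ ⊢* e ∷ es ⇓ v ∷ vs ⟨ c + d ⟩
  _∷*_ {e = e} {c = c} {es = es} {d = d} (cost r₁ p) (cost r₂ q) =
    cost (r₁ ∷ r₂) (add-bounds (nodes e) (nodes* es) c d p q)

-- The program

pattern combineᶠ   = zero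
pattern constantᶠ  = suc zero
pattern isEmptyᶠ   = suc (suc zero)
pattern initialᶠ   = suc (suc (suc zero))
pattern subtractᶠ  = suc (suc (suc (suc zero)))
pattern headsᶠ     = suc (suc (suc (suc (suc zero))))
pattern tailsᶠ     = suc (suc (suc (suc (suc (suc zero)))))
pattern aggregateᶠ = suc (suc (suc (suc (suc (suc (suc zero))))))
pattern stepᶠ      = suc (suc (suc (suc (suc (suc (suc (suc zero)))))))
pattern stepsᶠ     = suc (suc (suc (suc (suc (suc (suc (suc (suc zero))))))))
pattern solveᶠ     = suc (suc (suc (suc (suc (suc (suc (suc (suc (suc zero)))))))))
pattern lookupᶠ    = suc (suc (suc (suc (suc (suc (suc (suc (suc (suc (suc zero))))))))))
pattern fullᶠ      = suc (suc (suc (suc (suc (suc (suc (suc (suc (suc (suc (suc zero)))))))))))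

arities : Vec ℕ 13
arities = 3 ∷ 2 ∷ 1 ∷ 2 ∷ 2 ∷ 1 ∷ 1 ∷ 4 ∷ 3 ∷ 4 ∷ 4 ∷ 2 ∷ 2 ∷ []

solver : Program
solver = record { functions = 13 ; arity = lookup arities ; body = body ; main = main }
  where
  ar : Fin 13 → ℕ
  ar = lookup arities

  -- Lists are also passed as counters: the colors, or a list of the same length,
  -- give the depth k of the tables, and the arena gives the number n of steps that
  -- solveᶠ repeats 2 ^ k times.
  body : ∀ g → Exp ar (ar g)
  body combineᶠ =
    -- A `nil` table is a false leaf: neutral for Eve, absorbing for Adam.
    case (var (# 1)) (case (var (# 0)) (var (# 2)) nil)
      (case (var (# 4)) (case (var (# 2)) (var (# 3)) nil)
        (cons (call combineᶠ (var (# 4) ∷ var (# 2) ∷ var (# 0) ∷ []))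
              (call combineᶠ (var (# 4) ∷ var (# 3) ∷ var (# 1) ∷ []))))
  body constantᶠ =
    case (var (# 1)) (var (# 0))
      (cons (call constantᶠ (var (# 2) ∷ var (# 1) ∷ []))
            (call constantᶠ (var (# 2) ∷ var (# 1) ∷ [])))
  body isEmptyᶠ =
    case (var (# 0)) (cons nil nil)
      (cons (call isEmptyᶠ (var (# 1) ∷ []))
            (call constantᶠ (nil ∷ var (# 1) ∷ [])))
  body initialᶠ =
    case (var (# 0)) nil
      (cons (call isEmptyᶠ (var (# 3) ∷ []))
            (call initialᶠ (var (# 1) ∷ var (# 3) ∷ [])))
  body subtractᶠ =
    case (var (# 0)) (var (# 1))
      (case (var (# 3)) nil
        (case (var (# 2))
          (cons (call subtractᶠ (var (# 3) ∷ var (# 0) ∷ []))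
                (call subtractᶠ (var (# 3) ∷ var (# 1) ∷ [])))
          (cons (call subtractᶠ (var (# 5) ∷ var (# 2) ∷ []))
                (call subtractᶠ (var (# 5) ∷ var (# 2) ∷ [])))))
  body headsᶠ =
    case (var (# 0)) nil
      (case (var (# 0)) nil (cons (var (# 0)) (call headsᶠ (var (# 3) ∷ []))))
  body tailsᶠ =
    case (var (# 0)) nil
      (case (var (# 0)) nil (cons (var (# 1)) (call tailsᶠ (var (# 3) ∷ []))))
  body aggregateᶠ =
    -- The encoding of a player coincides with that of the boolean `not (good P)`, so the player
    -- itself is passed as the neutral value.
    case (var (# 1)) (call constantᶠ (var (# 0) ∷ var (# 3) ∷ []))
      (case (var (# 4)) nil
        (case (var (# 2))
          (call aggregateᶠ (var (# 4) ∷ var (# 3) ∷ var (# 1) ∷ var (# 7) ∷ []))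
          (call combineᶠ (var (# 6) ∷ var (# 2) ∷
            call aggregateᶠ (var (# 6) ∷ var (# 5) ∷ var (# 3) ∷ var (# 9) ∷ []) ∷ []))))
  body stepᶠ =
    case (var (# 0)) nil
      (case (var (# 0)) nil
        (cons
          (call subtractᶠ (call headsᶠ (var (# 5) ∷ []) ∷
            call aggregateᶠ (var (# 0) ∷ var (# 1) ∷ var (# 6) ∷ var (# 5) ∷ []) ∷ []))
          (call stepᶠ (var (# 3) ∷ call tailsᶠ (var (# 5) ∷ []) ∷ var (# 6) ∷ []))))
  body stepsᶠ =
    case (var (# 0)) (var (# 3))
      (call stepsᶠ (var (# 1) ∷ var (# 3) ∷ var (# 4) ∷
        call stepᶠ (var (# 3) ∷ var (# 4) ∷ var (# 5) ∷ []) ∷ []))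
  body solveᶠ =
    case (var (# 0)) (call stepsᶠ (var (# 1) ∷ var (# 1) ∷ var (# 2) ∷ var (# 3) ∷ []))
      (call solveᶠ (var (# 1) ∷ var (# 3) ∷ var (# 4) ∷
        call solveᶠ (var (# 1) ∷ var (# 3) ∷ var (# 4) ∷ var (# 5) ∷ []) ∷ []))
  body lookupᶠ =
    case (var (# 0)) (case (var (# 1)) nil (var (# 0)))
      (case (var (# 3)) nil (call lookupᶠ (var (# 3) ∷ var (# 1) ∷ [])))
  body fullᶠ =
    case (var (# 0)) (var (# 1))
      (case (var (# 3)) nil (call fullᶠ (var (# 3) ∷ var (# 1) ∷ [])))

  main : Exp ar 1
  main =
    -- Encoded instances are nested pairs, so neither `nil` default is reached. The color sets serve
    -- both as the counter of doublings and as the matrix `H`.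
    case (var (# 0)) nil
      (case (var (# 1)) nil
        (call fullᶠ (var (# 0) ∷
          call lookupᶠ (var (# 1) ∷
            call solveᶠ (var (# 0) ∷ var (# 2) ∷ var (# 0) ∷
              call initialᶠ (var (# 2) ∷ var (# 0) ∷ []) ∷ []) ∷ []) ∷ [])))

-- Results and call counts of the program's functions

open Calls solver

infix 4 _⟦_⟧⇓_⟨_⟩
_⟦_⟧⇓_⟨_⟩ : ∀ g → Vec Tree (lookup arities g) → Tree → ℕ → Set
g ⟦ vs ⟧⇓ v ⟨ c ⟩ = vs ⊢ Program.body solver g ⇓ v ⟨ c ⟩

encodeTable : ∀ {k} → Table k → Tree
encodeTable (leaf b)   = encodeBool b
encodeTable (node l r) = encodeTable l ∙ encodeTable r

-- The number of calls of a function that calls itself twice at every level.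
dbl : ℕ → ℕ → ℕ
dbl c zero    = c
dbl c (suc k) = suc (dbl c k) + suc (dbl c k)

-- A true leaf and a node with two false leaves have the same encoding. On two true leaves the
-- program therefore recurses once more, into two pairs of `nil`, and rebuilds `nil ∙ nil`; hence
-- the base cost 2.
combineᶠ-⇓ : ∀ {k} P (t u : Table k) →
             combineᶠ ⟦ encodePlayer P ∷ encodeTable t ∷ encodeTable u ∷ [] ⟧⇓
             encodeTable (pointwise P t u) ⟨ dbl 2 k ⟩
combineᶠ-⇓ eve  (leaf false) (leaf b)     =
  weaken z≤n (⇓case-nil ⇓var (⇓case-nil ⇓var ⇓var))
combineᶠ-⇓ adam (leaf false) (leaf b)     =
  weaken z≤n (⇓case-nil ⇓var (⇓case-cons ⇓var ⇓nil))
combineᶠ-⇓ eve  (leaf true)  (leaf false) =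
  weaken z≤n (⇓case-cons ⇓var (⇓case-nil ⇓var (⇓case-nil ⇓var ⇓var)))
combineᶠ-⇓ adam (leaf true)  (leaf false) =
  weaken z≤n (⇓case-cons ⇓var (⇓case-nil ⇓var (⇓case-cons ⇓var ⇓nil)))
combineᶠ-⇓ eve  (leaf true)  (leaf true)  =
  ⇓case-cons ⇓var (⇓case-cons ⇓var (⇓cons
    (⇓call (⇓var ∷* ⇓var ∷* ⇓var ∷* []*) (⇓case-nil ⇓var (⇓case-nil ⇓var ⇓var)))
    (⇓call (⇓var ∷* ⇓var ∷* ⇓var ∷* []*) (⇓case-nil ⇓var (⇓case-nil ⇓var ⇓var)))))
combineᶠ-⇓ adam (leaf true)  (leaf true)  =
  ⇓case-cons ⇓var (⇓case-cons ⇓var (⇓cons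
    (⇓call (⇓var ∷* ⇓var ∷* ⇓var ∷* []*) (⇓case-nil ⇓var (⇓case-cons ⇓var ⇓nil)))
    (⇓call (⇓var ∷* ⇓var ∷* ⇓var ∷* []*) (⇓case-nil ⇓var (⇓case-cons ⇓var ⇓nil)))))
combineᶠ-⇓ P (node l r) (node l′ r′) =
  ⇓case-cons ⇓var (⇓case-cons ⇓var (⇓cons
    (⇓call (⇓var ∷* ⇓var ∷* ⇓var ∷* []*) (combineᶠ-⇓ P l l′))
    (⇓call (⇓var ∷* ⇓var ∷* ⇓var ∷* []*) (combineᶠ-⇓ P r r′))))

module _ {A : Set} (enc : A → Tree) where

  constantᶠ-⇓ : ∀ {k} b (cs : Vec A k) →
                constantᶠ ⟦ encodeBool b ∷ encodeVec enc cs ∷ [] ⟧⇓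
                encodeTable (constant b k) ⟨ dbl 2 k ⟩
  constantᶠ-⇓ b []       = weaken z≤n (⇓case-nil ⇓var ⇓var)
  constantᶠ-⇓ b (_ ∷ cs) = ⇓case-cons ⇓var (⇓cons
    (⇓call (⇓var ∷* ⇓var ∷* []*) (constantᶠ-⇓ b cs))
    (⇓call (⇓var ∷* ⇓var ∷* []*) (constantᶠ-⇓ b cs)))

  isEmptyᶠ-⇓ : ∀ {k} (cs : Vec A k) →
               isEmptyᶠ ⟦ encodeVec enc cs ∷ [] ⟧⇓ encodeTable (isEmpty k) ⟨ dbl 2 k ⟩
  isEmptyᶠ-⇓ []       = weaken z≤n (⇓case-nil ⇓var (⇓cons ⇓nil ⇓nil))
  isEmptyᶠ-⇓ (_ ∷ cs) = ⇓case-cons ⇓var (⇓cons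
    (⇓call (⇓var ∷* []*) (isEmptyᶠ-⇓ cs))
    (⇓call (⇓nil ∷* ⇓var ∷* []*) (constantᶠ-⇓ false cs)))

  initialᶠ-⇓ : ∀ {B : Set} (enc′ : B → Tree) {k n} (vs : Vec B n) (cs : Vec A k) →
               initialᶠ ⟦ encodeVec enc′ vs ∷ encodeVec enc cs ∷ [] ⟧⇓
               encodeVec encodeTable (replicate n (isEmpty k)) ⟨ n * (2 + dbl 2 k) ⟩
  initialᶠ-⇓ enc′         []       cs = ⇓case-nil ⇓var ⇓nil
  initialᶠ-⇓ enc′ {k} {suc n} (_ ∷ vs) cs =
    weaken (≤-reflexive (+-suc (suc (dbl 2 k)) _)) (⇓case-cons ⇓var (⇓cons
      (⇓call (⇓var ∷* []*) (isEmptyᶠ-⇓ cs))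
      (⇓call (⇓var ∷* ⇓var ∷* []*) (initialᶠ-⇓ enc′ vs cs))))

  fullᶠ-⇓ : ∀ {k} (cs : Vec A k) (t : Table k) →
            fullᶠ ⟦ encodeVec enc cs ∷ encodeTable t ∷ [] ⟧⇓ encodeBool (t at ⊤) ⟨ k ⟩
  fullᶠ-⇓ []       (leaf b)   = ⇓case-nil ⇓var ⇓var
  fullᶠ-⇓ (_ ∷ cs) (node l r) = ⇓case-cons ⇓var (⇓case-cons ⇓var
    (⇓call (⇓var ∷* ⇓var ∷* []*) (fullᶠ-⇓ cs r)))

  lookupᶠ-⇓ : ∀ {n} (i : Fin n) (xs : Vec A n) →
              lookupᶠ ⟦ encodeℕ (toℕ i) ∷ encodeVec enc xs ∷ [] ⟧⇓ enc (lookup xs i) ⟨ n ⟩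
  lookupᶠ-⇓ zero    (x ∷ xs) = weaken z≤n (⇓case-nil ⇓var (⇓case-cons ⇓var ⇓var))
  lookupᶠ-⇓ (suc i) (x ∷ xs) = ⇓case-cons ⇓var (⇓case-cons ⇓var
    (⇓call (⇓var ∷* ⇓var ∷* []*) (lookupᶠ-⇓ i xs)))

subtractᶠ-⇓ : ∀ {k} (C : Subset k) t →
              subtractᶠ ⟦ encodeSubset C ∷ encodeTable t ∷ [] ⟧⇓
              encodeTable (subtract C t) ⟨ dbl 2 k ⟩
subtractᶠ-⇓ []          t          = weaken z≤n (⇓case-nil ⇓var ⇓var)
subtractᶠ-⇓ (false ∷ C) (node l r) =
  ⇓case-cons ⇓var (⇓case-cons ⇓var (⇓case-nil ⇓var (⇓cons
    (⇓call (⇓var ∷* ⇓var ∷* []*) (subtractᶠ-⇓ C l))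
    (⇓call (⇓var ∷* ⇓var ∷* []*) (subtractᶠ-⇓ C r)))))
subtractᶠ-⇓ (true ∷ C)  (node l r) =
  ⇓case-cons ⇓var (⇓case-cons ⇓var (⇓case-cons ⇓var (⇓cons
    (⇓call (⇓var ∷* ⇓var ∷* []*) (subtractᶠ-⇓ C l))
    (⇓call (⇓var ∷* ⇓var ∷* []*) (subtractᶠ-⇓ C l)))))

headsᶠ-⇓ : ∀ {k m} (H : Vec (Subset (suc m)) k) →
           headsᶠ ⟦ encodeVec encodeSubset H ∷ [] ⟧⇓ encodeSubset (map head H) ⟨ k ⟩
headsᶠ-⇓ []            = ⇓case-nil ⇓var ⇓nil
headsᶠ-⇓ ((_ ∷ _) ∷ H) = ⇓case-cons ⇓var (⇓case-cons ⇓var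
  (⇓cons ⇓var (⇓call (⇓var ∷* []*) (headsᶠ-⇓ H))))

tailsᶠ-⇓ : ∀ {k m} (H : Vec (Subset (suc m)) k) →
           tailsᶠ ⟦ encodeVec encodeSubset H ∷ [] ⟧⇓ encodeVec encodeSubset (map tail H) ⟨ k ⟩
tailsᶠ-⇓ []            = ⇓case-nil ⇓var ⇓nil
tailsᶠ-⇓ ((_ ∷ _) ∷ H) = ⇓case-cons ⇓var (⇓case-cons ⇓var
  (⇓cons ⇓var (⇓call (⇓var ∷* []*) (tailsᶠ-⇓ H))))

aggregateCalls : ℕ → ℕ → ℕ
aggregateCalls k m = m * (2 + dbl 2 k) + suc (dbl 2 k)

aggregateᶠ-⇓ : ∀ {k m n} P (es : Subset m) (X : Vec (Table k) m) (H : Vec (Subset n) k) →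
               aggregateᶠ ⟦ encodePlayer P ∷ encodeSubset es ∷ encodeVec encodeTable X ∷
                            encodeVec encodeSubset H ∷ [] ⟧⇓
               encodeTable (aggregate P es X) ⟨ aggregateCalls k m ⟩
aggregateᶠ-⇓ eve  [] [] H =
  ⇓case-nil ⇓var (⇓call (⇓var ∷* ⇓var ∷* []*) (constantᶠ-⇓ encodeSubset false H))
aggregateᶠ-⇓ adam [] [] H =
  ⇓case-nil ⇓var (⇓call (⇓var ∷* ⇓var ∷* []*) (constantᶠ-⇓ encodeSubset true H))
aggregateᶠ-⇓ {k} P (false ∷ es) (t ∷ X) H =
  weaken (+-monoˡ-≤ _ (s≤s (m≤n+m _ (suc (dbl 2 k)))))
    (⇓case-cons ⇓var (⇓case-cons ⇓var (⇓case-nil ⇓var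
      (⇓call (⇓var ∷* ⇓var ∷* ⇓var ∷* ⇓var ∷* []*) (aggregateᶠ-⇓ P es X H)))))
aggregateᶠ-⇓ {k} {suc m} P (true ∷ es) (t ∷ X) H =
  weaken (≤-reflexive (eq (dbl 2 k) (m * (2 + dbl 2 k))))
    (⇓case-cons ⇓var (⇓case-cons ⇓var (⇓case-cons ⇓var
      (⇓call (⇓var ∷* ⇓var ∷*
              ⇓call (⇓var ∷* ⇓var ∷* ⇓var ∷* ⇓var ∷* []*) (aggregateᶠ-⇓ P es X H) ∷* []*)
        (combineᶠ-⇓ P t (aggregate P es X))))))
  where
  eq : ∀ d a → suc (suc (a + suc d) + 0 + d) ≡ 2 + d + a + suc d
  eq = solve-∀

encodeRow : ∀ {n} → Player × Subset n → Tree
encodeRow (P , es) = encodePlayer P ∙ encodeSubset es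

rowCalls : ℕ → ℕ → ℕ
rowCalls k n = 4 + (k + k + (aggregateCalls k n + dbl 2 k)) + 1

stepᶠ-⇓ : ∀ {k m n} (rows : Vec (Player × Subset n) m) (H : Vec (Subset m) k) X →
          stepᶠ ⟦ encodeVec encodeRow rows ∷ encodeVec encodeSubset H ∷
                  encodeVec encodeTable X ∷ [] ⟧⇓
          encodeVec encodeTable (step rows H X) ⟨ m * rowCalls k n ⟩
stepᶠ-⇓ []                H X = ⇓case-nil ⇓var ⇓nil
stepᶠ-⇓ {k} {suc m} {n} ((P , es) ∷ rows) H X =
  weaken (≤-reflexive (eq k (aggregateCalls k n) (dbl 2 k) (m * rowCalls k n)))
    (⇓case-cons ⇓var (⇓case-cons ⇓var (⇓cons
      (⇓call (⇓call (⇓var ∷* []*) (headsᶠ-⇓ H) ∷*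
              ⇓call (⇓var ∷* ⇓var ∷* ⇓var ∷* ⇓var ∷* []*) (aggregateᶠ-⇓ P es X H) ∷* []*)
        (subtractᶠ-⇓ (map head H) (aggregate P es X)))
      (⇓call (⇓var ∷* ⇓call (⇓var ∷* []*) (tailsᶠ-⇓ H) ∷* ⇓var ∷* []*)
        (stepᶠ-⇓ rows (map tail H) X)))))
  where
  eq : ∀ k a d r → suc (suc k + (suc a + 0) + d) + suc (suc k + 0 + r) ≡
                   4 + (k + k + (a + d)) + 1 + r
  eq = solve-∀

-- `stepsᶠ` transforms its accumulator before recursing, whereas `fold` applies the function last.
fold-suc : ∀ {A : Set} (z : A) s n → fold (s z) s n ≡ s (fold z s n)
fold-suc z s zero    = refl
fold-suc z s (suc n) = cong s (fold-suc z s n)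

2*-distrib : ∀ q n → 2 * q * n ≡ q * n + q * n
2*-distrib = solve-∀

stepCalls : ℕ → ℕ → ℕ
stepCalls k n = n * rowCalls k n

-- The base cost is one call of `stepsᶠ` that performs `n` steps; each color doubles it.
solveCalls : ℕ → ℕ → ℕ → ℕ
solveCalls k n = dbl (suc (n * (2 + stepCalls k n)))

module _ {k n} (rows : Vec (Player × Subset n) n) (H : Vec (Subset n) k) where

  stepsᶠ-⇓ : ∀ {A : Set} (enc : A → Tree) {m} (as : Vec A m) X →
             stepsᶠ ⟦ encodeVec enc as ∷ encodeVec encodeRow rows ∷
                      encodeVec encodeSubset H ∷ encodeVec encodeTable X ∷ [] ⟧⇓
             encodeVec encodeTable (fold X (step rows H) m) ⟨ m * (2 + stepCalls k n) ⟩
  stepsᶠ-⇓ enc []       X = ⇓case-nil ⇓var ⇓var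
  stepsᶠ-⇓ enc {suc m} (_ ∷ as) X rewrite sym (fold-suc X (step rows H) m) =
    weaken (≤-reflexive (eq (stepCalls k n) (m * (2 + stepCalls k n)))) (⇓case-cons ⇓var
      (⇓call (⇓var ∷* ⇓var ∷* ⇓var ∷*
              ⇓call (⇓var ∷* ⇓var ∷* ⇓var ∷* []*) (stepᶠ-⇓ rows H X) ∷* []*)
        (stepsᶠ-⇓ enc as (step rows H X))))
    where
    eq : ∀ s r → suc (suc s + 0 + r) ≡ 2 + s + r
    eq = solve-∀

  solveᶠ-⇓ : ∀ {j} (cs : Vec (Subset n) j) X →
             solveᶠ ⟦ encodeVec encodeSubset cs ∷ encodeVec encodeRow rows ∷
                      encodeVec encodeSubset H ∷ encodeVec encodeTable X ∷ [] ⟧⇓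
             encodeVec encodeTable (fold X (step rows H) (2 ^ j * n)) ⟨ solveCalls k n j ⟩
  solveᶠ-⇓ [] X rewrite +-identityʳ n =
    ⇓case-nil ⇓var (⇓call (⇓var ∷* ⇓var ∷* ⇓var ∷* ⇓var ∷* []*) (stepsᶠ-⇓ encodeRow rows X))
  solveᶠ-⇓ {suc j} (_ ∷ cs) X
    rewrite trans (cong (fold X (step rows H)) (2*-distrib (2 ^ j) n))
                  (fold-+ X (step rows H) (2 ^ j * n) {2 ^ j * n}) =
    weaken (≤-reflexive (eq (solveCalls k n j))) (⇓case-cons ⇓var
      (⇓call (⇓var ∷* ⇓var ∷* ⇓var ∷*
              ⇓call (⇓var ∷* ⇓var ∷* ⇓var ∷* ⇓var ∷* []*) (solveᶠ-⇓ cs X) ∷* []*)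
        (solveᶠ-⇓ cs _)))
    where
    eq : ∀ s → suc (suc s + 0 + s) ≡ suc s + suc s
    eq = solve-∀

-- Time bounds

-- A class of functions that is closed under sums and products and whose members
-- are visibly of the form f(k) · poly(s).
module Bounds {I : Set} (k s : I → ℕ) (2≤s : ∀ x → 2 ≤ s x) where

  M : I → ℕ
  M x = 2 ^ k x * s x

  Bounded : (I → ℕ) → Set
  Bounded g = ∃[ e ] (∀ x → g x ≤ M x ^ e)

  private
    1≤2^k : ∀ x → 1 ≤ 2 ^ k x
    1≤2^k x = m^n>0 2 (k x)

    s≤M : ∀ x → s x ≤ M x
    s≤M x = ≤-trans (≤-reflexive (sym (*-identityˡ (s x)))) (*-monoˡ-≤ (s x) (1≤2^k x))

    2≤M : ∀ x → 2 ≤ M x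
    2≤M x = ≤-trans (2≤s x) (s≤M x)

    M^-mono : ∀ x {i j} → i ≤ j → M x ^ i ≤ M x ^ j
    M^-mono x = ^-monoʳ-≤ (M x) {{>-nonZero (≤-trans (s≤s z≤n) (2≤M x))}}

    M¹ : ∀ x {m} → m ≤ M x → m ≤ M x ^ 1
    M¹ x m≤M = ≤-trans m≤M (≤-reflexive (sym (*-identityʳ (M x))))

  bounded-≤ : ∀ {g h} → (∀ x → g x ≤ h x) → Bounded h → Bounded g
  bounded-≤ g≤h (e , h≤) = e , λ x → ≤-trans (g≤h x) (h≤ x)

  bounded-size : Bounded s
  bounded-size = 1 , λ x → M¹ x (s≤M x)

  bounded-2^k : Bounded (λ x → 2 ^ k x)
  bounded-2^k = 1 , λ x → M¹ x (≤-trans (≤-reflexive (sym (*-identityʳ (2 ^ k x))))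
    (*-monoʳ-≤ (2 ^ k x) (≤-trans (s≤s z≤n) (2≤s x))))

  infixl 6 _+ᵇ_
  infixl 7 _*ᵇ_

  _*ᵇ_ : ∀ {g h} → Bounded g → Bounded h → Bounded (λ x → g x * h x)
  (i , g≤) *ᵇ (j , h≤) = i + j , λ x →
    ≤-trans (*-mono-≤ (g≤ x) (h≤ x)) (≤-reflexive (sym (^-distribˡ-+-* (M x) i j)))

  _+ᵇ_ : ∀ {g h} → Bounded g → Bounded h → Bounded (λ x → g x + h x)
  -- Both summands are at most `M x ^ (i + j)`, and the extra factor in the exponent absorbs the 2
  -- because `2 ≤ M x`.
  (i , g≤) +ᵇ (j , h≤) = suc (i + j) , λ x →
    ≤-trans (+-mono-≤ (≤-trans (g≤ x) (M^-mono x (m≤m+n i j)))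
                      (≤-trans (h≤ x) (M^-mono x (m≤n+m j i))))
      (≤-trans (≤-reflexive (cong (M x ^ (i + j) +_) (sym (+-identityʳ _))))
        (*-monoˡ-≤ (M x ^ (i + j)) (2≤M x)))

  bounded-const : ∀ c → Bounded (λ _ → c)
  bounded-const zero    = 0 , λ _ → z≤n
  bounded-const (suc c) = (0 , λ _ → ≤-refl) +ᵇ bounded-const c

-- Adding 2 turns the recurrence, which doubles and adds 2, into pure doubling.
dbl-≤ : ∀ c k → dbl c k ≤ 2 ^ k * (c + 2)
dbl-≤ c k = ≤-trans (m≤m+n (dbl c k) 2) (≤-reflexive (dbl+2 c k))
  where
  dbl+2 : ∀ c k → dbl c k + 2 ≡ 2 ^ k * (c + 2)
  dbl+2 c zero    = sym (*-identityˡ (c + 2))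
  dbl+2 c (suc k) = trans (shift (dbl c k))
    (trans (cong (2 *_) (dbl+2 c k)) (sym (*-assoc 2 (2 ^ k) (c + 2))))
    where
    shift : ∀ d → suc d + suc d + 2 ≡ 2 * (d + 2)
    shift = solve-∀

monomial : ℕ → List ℕ
monomial zero    = 1 ∷ []
monomial (suc e) = 0 ∷ monomial e

evalPoly-monomial : ∀ e s → evalPoly (monomial e) s ≡ s ^ e
evalPoly-monomial zero    s = cong suc (*-zeroʳ s)
evalPoly-monomial (suc e) s = cong (s *_) (evalPoly-monomial e s)

*-^ : ∀ a b e → (a * b) ^ e ≡ a ^ e * b ^ e
*-^ a b zero    = refl
*-^ a b (suc e) = trans (cong (a * b *_) (*-^ a b e)) (interchange a b (a ^ e) (b ^ e))
  where
  interchange : ∀ a b c d → a * b * (c * d) ≡ a * c * (b * d)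
  interchange = solve-∀

-- The exponent e is a constant of the program, which doubles e times per level.
module Power (e : ℕ) where

  pattern doubleᶠ = zero
  pattern powerᶠ  = suc zero

  ar : Fin 2 → ℕ
  ar _ = 1

  doubles : ∀ {n} → ℕ → Exp ar n → Exp ar n
  doubles zero    x = x
  doubles (suc i) x = call doubleᶠ (doubles i x ∷ [])

  body : ∀ g → Exp ar (ar g)
  body doubleᶠ = case (var (# 0)) nil (cons nil (cons nil (call doubleᶠ (var (# 1) ∷ []))))
  body powerᶠ  = case (var (# 0)) (cons nil nil) (doubles e (call powerᶠ (var (# 1) ∷ [])))

  program : Program
  program = record
    { functions = 2 ; arity = ar ; body = body ; main = call powerᶠ (var (# 0) ∷ []) }

  double-eval : ∀ n → ∃[ t ] Eval program (encodeℕ n ∷ []) (body doubleᶠ) (encodeℕ (n + n)) t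
  double-eval zero    = _ , case-nil (var _) nil
  double-eval (suc n) rewrite +-suc n n =
    _ , case-cons (var _) (cons nil (cons nil (call (var _ ∷ []) (proj₂ (double-eval n)))))

  doubles-eval : ∀ i {n} {ρ : Vec Tree n} {x m t} → Eval program ρ x (encodeℕ m) t →
                 ∃[ t′ ] Eval program ρ (doubles i x) (encodeℕ (2 ^ i * m)) t′
  doubles-eval zero    {m = m} r rewrite *-identityˡ m = _ , r
  doubles-eval (suc i) {m = m} r rewrite 2*-distrib (2 ^ i) m =
    _ , call (proj₂ (doubles-eval i r) ∷ []) (proj₂ (double-eval (2 ^ i * m)))

  power-eval : ∀ n → ∃[ t ] Eval program (encodeℕ n ∷ []) (body powerᶠ) (encodeℕ ((2 ^ e) ^ n)) t
  power-eval zero    = _ , case-nil (var _) (cons nil nil)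
  power-eval (suc n) = _ , case-cons (var _)
    (proj₂ (doubles-eval e (call (var _ ∷ []) (proj₂ (power-eval n)))))

  computable : Computable ((2 ^ e) ^_)
  computable = program , λ n → _ , call (var _ ∷ []) (proj₂ (power-eval n))

-- The solver on encoded instances

length≤size : ∀ {A : Set} (enc : A → Tree) {n} (xs : Vec A n) → n ≤ size (encodeVec enc xs)
length≤size enc []       = z≤n
length≤size enc (x ∷ xs) = s≤s (m≤n⇒m≤o+n (size (enc x)) (length≤size enc xs))

-- `encodeArena` tabulates rows that are already trees; this identifies the result with the encoding
-- of `rows` by `encodeRow`.
encodeVec-tabulate : ∀ {A : Set} (enc : A → Tree) {n} (f : Fin n → A) →
                     encodeVec (λ t → t) (tabulate (enc ∘ f)) ≡ encodeVec enc (tabulate f)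
encodeVec-tabulate enc {zero}  f = refl
encodeVec-tabulate enc {suc n} f = cong (enc (f zero) ∙_) (encodeVec-tabulate enc (f ∘ suc))

mainCalls : ∀ i s n k → 4 + (i + 0 + s + 0 + n + 0 + k) ≡ 4 + (i + s + n + k)
mainCalls = solve-∀

open ParameterizedProblem GenReachProblem

module _ (x : GenReachInstance) where

  open GenReachInstance x using (𝒜; F; v₀) renaming (colors to k)
  open Arena 𝒜 using (order; owner; edgesFrom)
  open Solution x using (rows; X; W; rounds)

  private
    n = order

  calls : ℕ
  calls = 4 + (n * (2 + dbl 2 k) + solveCalls k n k + n + k)

  solver-⇓ : (encode x ∷ []) ⊢ Program.main solver ⇓ encodeBool (W rounds v₀ ⊤) ⟨ calls ⟩
  solver-⇓ rewrite encodeVec-tabulate encodeRow (λ v → owner v , edgesFrom v) =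
    weaken (≤-reflexive (mainCalls (n * (2 + dbl 2 k)) (solveCalls k n k) n k))
      (⇓case-cons ⇓var (⇓case-cons ⇓var (⇓call (⇓var ∷* ⇓call (⇓var ∷*
        ⇓call (⇓var ∷* ⇓var ∷* ⇓var ∷*
          ⇓call (⇓var ∷* ⇓var ∷* []*) (initialᶠ-⇓ encodeSubset encodeRow rows F) ∷* []*)
        (solveᶠ-⇓ rows F F _) ∷* []*)
      (lookupᶠ-⇓ encodeTable v₀ _) ∷* []*)
      (fullᶠ-⇓ encodeSubset F (lookup (X rounds) v₀)))))

  order≤size : n ≤ size (encode x)
  order≤size = m≤n⇒m≤1+n (m≤n⇒m≤n+o _
    (length≤size (λ t → t) (tabulate λ v → encodeRow (owner v , edgesFrom v))))

  colors≤size : k ≤ size (encode x)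
  colors≤size = m≤n⇒m≤1+n (m≤n⇒m≤o+n (size (encodeArena 𝒜))
    (m≤n⇒m≤1+n (m≤n⇒m≤n+o _ (length≤size encodeSubset F))))

  2≤size : 2 ≤ size (encode x)
  2≤size = s≤s (m≤n⇒m≤o+n (size (encodeArena 𝒜)) (s≤s z≤n))

open Bounds parameter (size ∘ encode) 2≤size

time-bounded : Bounded (λ x → nodes (Program.main solver) + K * calls x)
-- The term mirrors the definition of `calls` summand by summand.
time-bounded = bounded-const (nodes (Program.main solver)) +ᵇ bounded-const K *ᵇ
  (bounded-const 4 +ᵇ (nᵇ *ᵇ (bounded-const 2 +ᵇ dᵇ) +ᵇ solveᵇ +ᵇ nᵇ +ᵇ kᵇ))
  where
  1ᵇ : Bounded (λ _ → 1)
  1ᵇ = bounded-const 1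

  nᵇ : Bounded (λ x → Arena.order (GenReachInstance.𝒜 x))
  nᵇ = bounded-≤ order≤size bounded-size

  kᵇ : Bounded parameter
  kᵇ = bounded-≤ colors≤size bounded-size

  dblᵇ : ∀ {g} → Bounded g → Bounded (λ x → dbl (g x) (parameter x))
  dblᵇ gᵇ = bounded-≤ (λ x → dbl-≤ _ (parameter x)) (bounded-2^k *ᵇ (gᵇ +ᵇ bounded-const 2))

  dᵇ : Bounded (λ x → dbl 2 (parameter x))
  dᵇ = dblᵇ (bounded-const 2)

  rowᵇ : Bounded (λ x → rowCalls (parameter x) (Arena.order (GenReachInstance.𝒜 x)))
  rowᵇ = bounded-const 4 +ᵇ
    (kᵇ +ᵇ kᵇ +ᵇ (nᵇ *ᵇ (bounded-const 2 +ᵇ dᵇ) +ᵇ (1ᵇ +ᵇ dᵇ) +ᵇ dᵇ)) +ᵇ 1ᵇ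

  solveᵇ : Bounded (λ x → let n = Arena.order (GenReachInstance.𝒜 x) in
                          solveCalls (parameter x) n (parameter x))
  solveᵇ = dblᵇ (1ᵇ +ᵇ nᵇ *ᵇ (bounded-const 2 +ᵇ nᵇ *ᵇ rowᵇ))

theorem2 : FPT GenReachProblem
theorem2 = let (e , time≤M^e) = time-bounded in
  -- The bound `(2 ^ k * s) ^ e` splits into a factor in `k` and the monomial `s ^ e`. The former is
  -- written `(2 ^ e) ^ k`, the form that `Power` computes by recursion on `k`.
  solver , ((2 ^ e) ^_) , monomial e , Power.computable e , λ x →
  let cost run time≤ = solver-⇓ x
      k = parameter x
      s = size (encode x)
  in _ , _ , run ,
     ≤-trans time≤ (≤-trans (time≤M^e x) (≤-reflexive (begin
       (2 ^ k * s) ^ e                         ≡⟨ *-^ (2 ^ k) s e ⟩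
       (2 ^ k) ^ e * s ^ e
         ≡⟨ cong₂ _*_ (^-swap k e) (sym (evalPoly-monomial e s)) ⟩
       (2 ^ e) ^ k * evalPoly (monomial e) s   ∎))) ,
     Solution.correct x
  where
  open ≡-Reasoning
  ^-swap : ∀ i j → (2 ^ i) ^ j ≡ (2 ^ j) ^ i
  ^-swap i j = trans (^-*-assoc 2 i j) (trans (cong (2 ^_) (*-comm i j)) (sym (^-*-assoc 2 j i)))
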